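{- Let $\ell\ge r\ge2$ and let $\mathcal{H}$ be a $\mathcal{K}_{\ell+1}^r$-free $r$-graph. Then \[ \left(\frac{|\mathcal{H}|}{\binom{\ell}{r}}\right)^{1/r}\le\left(\frac{|\partial\mathcal{H}|}{\binom{\ell}{r-1}}\right)^{1/(r-1)}. \]
   Context: An $r$-graph $\mathcal{H}$ is a finite vertex set $V(\mathcal{H})$ together with a set of $r$-element subsets (edges). The shadow is $\partial\mathcal{H}=\{A\in\binom{V(\mathcal{H})}{r-1}: A\subset B\text{ for some }B\in\mathcal{H}\}$. $\mathcal{K}_{\ell+1}^r$ is the collection of all $r$-graphs $F$ with at most $\binom{\ell+1}{2}$ edges such that for some $(\ell+1)$-set $S$ every pair $\{u,v\}\subset S$ is contained in some edge of $F$; $\mathcal{H}$ is $\mathcal{K}_{\ell+1}^r$-free if it contains no member of $\mathcal{K}_{\ell+1}^r$ as a (not necessarily induced) subgraph. -}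

module Defs where

open import Data.Nat using (ℕ; zero; suc; _≤_; _∸_)
open import Data.Nat.Properties using (_≟_)
open import Data.Nat.Combinatorics using (_C_)
open import Data.Fin using (Fin)
open import Data.Fin.Subset using (Subset; _⊆_; ∣_∣; inside; outside) renaming (_∈_ to _∈ₛ_)
open import Data.Fin.Subset.Properties using (_⊆?_)
open import Data.Vec using (_∷_; [])
open import Data.List using (List; []; _∷_; _++_; map; filter; length)
open import Data.List.Relation.Unary.All using (All)
open import Data.List.Relation.Unary.Any using (Any; any?)
open import Data.List.Relation.Unary.Unique.Propositional using (Unique)
open import Data.List.Membership.Propositional renaming (_∈_ to _∈ₗ_)
open import Data.Product using (Σ; _×_; ∃)
open import Relation.Nullary.Decidable using (_×-dec_)
open import Relation.Binary.PropositionalEquality using (_≡_; _≢_)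
open import Data.Empty using (⊥)

record RGraph (n r : ℕ) : Set where
  field
    edges   : List (Subset n)
    unique  : Unique edges
    uniform : All (λ e → ∣ e ∣ ≡ r) edges
open RGraph public

size : ∀ {n r} → RGraph n r → ℕ
size H = length (edges H)

allSubsets : (n : ℕ) → List (Subset n)
allSubsets zero    = [] ∷ []
allSubsets (suc n) = map (inside ∷_) (allSubsets n) ++ map (outside ∷_) (allSubsets n)

shadow : ∀ {n r} → RGraph n r → List (Subset n)
shadow {n} {r} H =
  filter (λ A → (∣ A ∣ ≟ r ∸ 1) ×-dec any? (A ⊆?_) (edges H)) (allSubsets n)

shadowSize : ∀ {n r} → RGraph n r → ℕ
shadowSize H = length (shadow H)

-- H contains a member of 𝒦^r_{ℓ+1}: a subgraph F (a set of edges of H)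
-- with at most C(ℓ+1,2) edges and an (ℓ+1)-set S every pair of which
-- lies in some edge of F.
ContainsK : ∀ {n r} → ℕ → RGraph n r → Set
ContainsK {n} ℓ H =
  Σ (List (Subset n)) λ F →
    Unique F × All (_∈ₗ edges H) F × length F ≤ suc ℓ C 2 ×
    Σ (Subset n) λ S → ∣ S ∣ ≡ suc ℓ ×
      (∀ u v → u ∈ₛ S → v ∈ₛ S → u ≢ v → Any (λ e → u ∈ₛ e × v ∈ₛ e) F)

KFree : ∀ {n r} → ℕ → RGraph n r → Set
KFree ℓ H = ContainsK ℓ H → ⊥

{-# OPTIONS --safe #-}
module Submission where

-- The entropy method, exponentiated so that only natural numbers occur. Let (X₁,…,X_r) be a
-- uniformly random ordered edge, M = r!|H|, and c_j = H(X_j | X₁,…,X_{j-1}). Given X₁,…,X_{j-1},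
-- the pair (X_j, X_{j+1}) is symmetric and lives on a graph without K_{ℓ-j+2}; comparing it with
-- the product of its marginals, Gibbs' inequality and Motzkin–Straus give
-- c_j - c_{j+1} ≥ log((ℓ-j+1)/(ℓ-j)). Since log M = c₁ + … + c_r and
-- c₁ + … + c_{r-1} = H(X₁,…,X_{r-1}) ≤ log((r-1)!|∂H|), summing these bounds gives the claim.

open import Defs
open import Data.Bool using (if_then_else_)
import Data.Bool.Properties as Bool
open import Data.Nat hiding (∣_-_∣)
open import Data.Nat.Properties
open import Data.Nat.Combinatorics using (_C_; nCk≡n!/k![n-k]!; k![n∸k]!∣n!; nCk+nC[k+1]≡[n+1]C[k+1]; nC1≡n)
open import Data.Nat.DivMod using (m/n*n≡m)
open import Data.Nat.Tactic.RingSolver using (solve-∀)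
open import Data.Fin using (Fin; zero; suc)
import Data.Fin.Properties as Fin
open import Data.Fin.Subset using (Subset; _⊆_; _-_; ∣_∣; inside; outside; ⊥) renaming (_∈_ to _∈ₛ_)
open import Data.Fin.Subset.Properties using (_⊆?_; p─⊥≡p; p─x─y≡p─y─x; p─q⊆p; ∉⊥; ∣⊥∣≡0)
open import Data.Vec using ([]; _∷_; lookup; _[_]≔_)
open import Data.Vec.Properties using (≡-dec; []=⇒lookup; lookup⇒[]=; lookup∘updateAt′)
open import Data.List using (List; []; _∷_; _++_; length; map; foldr; deduplicate)
open import Data.List.Properties using (length-++; length-deduplicate)
open import Data.List.Relation.Unary.All as All using (All; []; _∷_)
import Data.List.Relation.Unary.All.Properties as All
open import Data.List.Relation.Unary.Any as Any using (Any; here; there; any?)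
import Data.List.Relation.Unary.Any.Properties as Any
open import Data.List.Relation.Unary.AllPairs as AllPairs using (AllPairs; []; _∷_)
open import Data.List.Relation.Unary.Unique.Propositional using (Unique)
import Data.List.Relation.Unary.Unique.DecPropositional.Properties as DecUnique
open import Data.List.Membership.Propositional using (find; lose) renaming (_∈_ to _∈ₗ_)
open import Data.List.Membership.Propositional.Properties
  using (∈-++⁺ˡ; ∈-++⁺ʳ; ∈-map⁺; ∈-filter⁺; ∈-deduplicate⁺)
open import Data.List.Relation.Binary.Permutation.Propositional using (_↭_; prep; swap; ↭-refl)
import Data.List.Relation.Binary.Permutation.Propositional as Perm
open import Data.List.Relation.Binary.Permutation.Propositional.Properties using (++-comm)
open import Data.Product using (∃; _×_; _,_; proj₁; proj₂)
open import Data.Sum using (inj₁; inj₂)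
open import Function using (_∘_; _$_)
open import Relation.Nullary using (¬_; contradiction; yes; no)
open import Relation.Nullary.Decidable using (_×-dec_)
open import Relation.Binary.PropositionalEquality
open import Algebra.Properties.Semiring.Sum +-*-semiring
  using (sum; sum-cong-≗; ∑-distrib-+; ∑-comm; *-distribˡ-sum; *-distribʳ-sum; sum-replicate-zero)
open import Algebra.Properties.CommutativeMonoid.Sum *-1-commutativeMonoid
  using () renaming (sum to prod; sum-cong-≗ to prod-cong; ∑-distrib-+ to prod-distrib-*; ∑-comm to prod-comm)

open ≤-Reasoning

-- Given the earlier vertices, X_j and X_(j+1) have the same law, so c_j - c_(j+1) is a conditional
-- mutual information: the relative entropy of the joint law with respect to the product of its
-- marginals. Cutting the product down to the support of the joint law lowers its mass to at most 1
-- - 1/(ℓ-j+1), and the logarithm of that loss is the drop. The last term c_r is the pivot. The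
-- drops bound every c_j below in terms of c_r, hence log M below by r c_r plus a constant; the
-- shadow bounds c_r below by log M - log((r-1)!|∂H|). Eliminating c_r leaves the inequality. To
-- stay within natural numbers, distributions are unnormalised integer weights and entropies are
-- multiplied by M, so they appear as products of powers x^x. The convention 0^0 = 1 discards null
-- events, and conditioning on a prefix becomes a plain product over prefixes. Quotients are
-- cross-multiplied, hence the many cancellations of provably nonzero factors.

-- Weighted AM-GM

^-distribʳ-* : ∀ k x y → (x * y) ^ k ≡ x ^ k * y ^ k
^-distribʳ-* zero    x y = refl
^-distribʳ-* (suc k) x y = trans (cong (x * y *_) (^-distribʳ-* k x y)) (arrange x y (x ^ k) (y ^ k))
  where
  arrange : ∀ x y a b → x * y * (a * b) ≡ x * a * (y * b)
  arrange = solve-∀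

2xy≤x²+y² : ∀ x y → 2 * (x * y) ≤ x * x + y * y
2xy≤x²+y² x y with ≤-total x y
... | inj₁ x≤y with m≤n⇒∃[o]m+o≡n x≤y
...   | d , refl = ≤-trans (m≤m+n _ (d * d)) (≤-reflexive (expand x d))
  where
  expand : ∀ x d → 2 * (x * (x + d)) + d * d ≡ x * x + (x + d) * (x + d)
  expand = solve-∀
2xy≤x²+y² x y | inj₂ y≤x with m≤n⇒∃[o]m+o≡n y≤x
...   | d , refl = ≤-trans (m≤m+n _ (d * d)) (≤-reflexive (expand y d))
  where
  expand : ∀ y d → 2 * ((y + d) * y) + d * d ≡ (y + d) * (y + d) + y * y
  expand = solve-∀

-- The tangent line of y ↦ yⁿ⁺¹ at z lies below the graph.
tangent-≤ : ∀ n y z → suc n * (z ^ n * y) ≤ y ^ suc n + n * z ^ suc n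
tangent-≤ zero    y z = ≤-reflexive (base y)
  where
  base : ∀ y → 1 * (1 * y) ≡ y * 1 + 0
  base = solve-∀
-- The added term completes the left side to a multiple of `2 * (y * z)`, so that (y - z)² ≥ 0 can
-- be used without subtraction.
tangent-≤ (suc n) y z = +-cancelʳ-≤ (n * (z * Z) * y) _ _ $ begin
  suc (suc n) * (z * Z * y) + n * (z * Z) * y
    ≡⟨ e₁ n y z Z ⟩
  suc n * Z * (2 * (y * z))
    ≤⟨ *-monoʳ-≤ (suc n * Z) (2xy≤x²+y² y z) ⟩
  suc n * Z * (y * y + z * z)
    ≡⟨ e₂ n y z Z ⟩
  suc n * (Z * y) * y + suc n * (z * (z * Z))
    ≤⟨ +-monoˡ-≤ _ (*-monoˡ-≤ y (tangent-≤ n y z)) ⟩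
  (y * Y + n * (z * Z)) * y + suc n * (z * (z * Z))
    ≡⟨ e₃ n y z Z Y ⟩
  y * (y * Y) + suc n * (z * (z * Z)) + n * (z * Z) * y ∎
  where
  Z = z ^ n
  Y = y ^ n
  e₁ : ∀ n y z Z → suc (suc n) * (z * Z * y) + n * (z * Z) * y ≡ suc n * Z * (2 * (y * z))
  e₁ = solve-∀
  e₂ : ∀ n y z Z → suc n * Z * (y * y + z * z) ≡ suc n * (Z * y) * y + suc n * (z * (z * Z))
  e₂ = solve-∀
  e₃ : ∀ n y z Z Y → (y * Y + n * (z * Z)) * y + suc n * (z * (z * Z)) ≡ y * (y * Y) + suc n * (z * (z * Z)) + n * (z * Z) * y
  e₃ = solve-∀

-- The tangent inequality at y = n (s + x), z = (n + 1) s.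
amgm-step : ∀ n s x → suc n ^ suc n * (s ^ n * x) ≤ n ^ n * (s + x) ^ suc n
amgm-step zero    s x = begin
  1 * (1 * x)        ≡⟨ trans (*-identityˡ _) (*-identityˡ x) ⟩
  x                  ≤⟨ m≤n+m x s ⟩
  s + x              ≡⟨ trans (*-identityˡ _) (*-identityʳ (s + x)) ⟨
  1 * ((s + x) * 1)  ∎
amgm-step n@(suc _) s x = *-cancelˡ-≤ n $ +-cancelʳ-≤ (n * (suc n * s) ^ suc n) _ _ $ begin
  n * (suc n ^ suc n * (s ^ n * x)) + n * (suc n * s) ^ suc n
    ≡⟨ cong (λ q → n * (suc n ^ suc n * (s ^ n * x)) + n * (suc n * s * q)) (^-distribʳ-* n (suc n) s) ⟩
  n * (suc n ^ suc n * (s ^ n * x)) + n * (suc n * s * (suc n ^ n * s ^ n))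
    ≡⟨ e₁ n s x (suc n ^ n) (s ^ n) ⟩
  suc n * (suc n ^ n * s ^ n * (n * (s + x)))
    ≡⟨ cong (λ q → suc n * (q * (n * (s + x)))) (^-distribʳ-* n (suc n) s) ⟨
  suc n * ((suc n * s) ^ n * (n * (s + x)))
    ≤⟨ tangent-≤ n (n * (s + x)) (suc n * s) ⟩
  (n * (s + x)) ^ suc n + n * (suc n * s) ^ suc n
    ≡⟨ cong (_+ n * (suc n * s) ^ suc n) (trans (^-distribʳ-* (suc n) n (s + x)) (*-assoc n (n ^ n) _)) ⟩
  n * (n ^ n * (s + x) ^ suc n) + n * (suc n * s) ^ suc n ∎
  where
  e₁ : ∀ n s x A B → n * (suc n * A * (B * x)) + n * (suc n * s * (A * B)) ≡ suc n * (A * B * (n * (s + x)))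
  e₁ = solve-∀

self^-nonZero : ∀ n → NonZero (n ^ n)
self^-nonZero zero    = _
self^-nonZero (suc n) = m^n≢0 (suc n) (suc n)

amgm : ∀ m w a b → (m + w) ^ (m + w) * (a ^ m * b ^ w) ≤ (m * a + w * b) ^ (m + w)
amgm m zero a b rewrite +-identityʳ m | *-identityʳ (a ^ m) | +-identityʳ (m * a) =
  ≤-reflexive (sym (^-distribʳ-* m m a))
amgm m (suc w) a b rewrite +-suc m w = *-cancelˡ-≤ (n ^ n) {{self^-nonZero n}} $ begin
  n ^ n * (suc n ^ suc n * (a ^ m * (b * b ^ w)))
    ≡⟨ e₁ (n ^ n) (suc n ^ suc n) (a ^ m) b (b ^ w) ⟩
  suc n ^ suc n * (n ^ n * (a ^ m * b ^ w) * b)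
    ≤⟨ *-monoʳ-≤ (suc n ^ suc n) (*-monoˡ-≤ b (amgm m w a b)) ⟩
  suc n ^ suc n * (s ^ n * b)
    ≤⟨ amgm-step n s b ⟩
  n ^ n * (s + b) ^ suc n
    ≡⟨ cong (λ q → n ^ n * q ^ suc n) (e₂ m w a b) ⟩
  n ^ n * (m * a + suc w * b) ^ suc n ∎
  where
  n = m + w
  s = m * a + w * b
  e₁ : ∀ A B C b D → A * (B * (C * (b * D))) ≡ B * (A * (C * D) * b)
  e₁ = solve-∀
  e₂ : ∀ m w a b → m * a + w * b + b ≡ m * a + suc w * b
  e₂ = solve-∀

-- Gibbs' inequality

-- Weighted AM-GM for c/m with weight m and s/w with weight w, the denominators cleared by the
-- factor m w. Zero weights are split off because powers of m and w are cancelled.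
gibbs₂ : ∀ m w c s → c ^ m * s ^ w * (m + w) ^ (m + w) ≤ (c + s) ^ (m + w) * (m ^ m * w ^ w)
gibbs₂ m zero c s rewrite +-identityʳ m = begin
  c ^ m * 1 * m ^ m          ≡⟨ cong (_* m ^ m) (*-identityʳ (c ^ m)) ⟩
  c ^ m * m ^ m              ≤⟨ *-monoˡ-≤ (m ^ m) (^-monoˡ-≤ m (m≤m+n c s)) ⟩
  (c + s) ^ m * m ^ m        ≡⟨ cong ((c + s) ^ m *_) (*-identityʳ (m ^ m)) ⟨
  (c + s) ^ m * (m ^ m * 1)  ∎
gibbs₂ zero w@(suc _) c s = begin
  1 * s ^ w * w ^ w          ≡⟨ cong (_* w ^ w) (*-identityˡ (s ^ w)) ⟩
  s ^ w * w ^ w              ≤⟨ *-monoˡ-≤ (w ^ w) (^-monoˡ-≤ w (m≤n+m s c)) ⟩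
  (c + s) ^ w * w ^ w        ≡⟨ cong ((c + s) ^ w *_) (*-identityˡ (w ^ w)) ⟨
  (c + s) ^ w * (1 * w ^ w)  ∎
gibbs₂ m@(suc _) w@(suc _) c s = *-cancelˡ-≤ (m ^ w * w ^ m) {{m*n≢0 _ _ {{m^n≢0 m w}} {{m^n≢0 w m}}}} $ begin
  m ^ w * w ^ m * (c ^ m * s ^ w * N ^ N)
    ≡⟨ e₁ (m ^ w) (w ^ m) (c ^ m) (s ^ w) (N ^ N) ⟩
  N ^ N * (c ^ m * w ^ m * (s ^ w * m ^ w))
    ≡⟨ cong (N ^ N *_) (cong₂ _*_ (^-distribʳ-* m c w) (^-distribʳ-* w s m)) ⟨
  N ^ N * ((c * w) ^ m * (s * m) ^ w)
    ≤⟨ amgm m w (c * w) (s * m) ⟩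
  (m * (c * w) + w * (s * m)) ^ N
    ≡⟨ cong (_^ N) (e₂ m w c s) ⟩
  (m * w * (c + s)) ^ N
    ≡⟨ trans (^-distribʳ-* N (m * w) (c + s)) (cong (_* (c + s) ^ N) (^-distribʳ-* N m w)) ⟩
  m ^ N * w ^ N * (c + s) ^ N
    ≡⟨ cong (_* (c + s) ^ N) (cong₂ _*_ (^-distribˡ-+-* m m w) (^-distribˡ-+-* w m w)) ⟩
  m ^ m * m ^ w * (w ^ m * w ^ w) * (c + s) ^ N
    ≡⟨ e₃ (m ^ m) (m ^ w) (w ^ m) (w ^ w) ((c + s) ^ N) ⟩
  m ^ w * w ^ m * ((c + s) ^ N * (m ^ m * w ^ w)) ∎
  where
  N = m + w
  e₁ : ∀ a b x y z → a * b * (x * y * z) ≡ z * (x * b * (y * a))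
  e₁ = solve-∀
  e₂ : ∀ m w c s → m * (c * w) + w * (s * m) ≡ m * w * (c + s)
  e₂ = solve-∀
  e₃ : ∀ a b x y z → a * b * (x * y) * z ≡ b * x * (z * (a * y))
  e₃ = solve-∀

-- Nonnegativity of the relative entropy of m/∑m with respect to c/∑c. The chain rule reduces it to
-- two masses: the head and the merged tail, whose own factor `W ^ W` cancels.
gibbs : ∀ {n} (m c : Fin n → ℕ) →
  prod (λ i → c i ^ m i) * sum m ^ sum m ≤ sum c ^ sum m * prod (λ i → m i ^ m i)
gibbs {zero}  m c = ≤-refl
gibbs {suc n} m c = *-cancelˡ-≤ (W ^ W) {{self^-nonZero W}} $ begin
  W ^ W * (c₀ ^ m₀ * Πc * V ^ V)
    ≡⟨ e₁ (W ^ W) (c₀ ^ m₀) Πc (V ^ V) ⟩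
  c₀ ^ m₀ * (V ^ V) * (Πc * W ^ W)
    ≤⟨ *-monoʳ-≤ (c₀ ^ m₀ * (V ^ V)) (gibbs (m ∘ suc) (c ∘ suc)) ⟩
  c₀ ^ m₀ * (V ^ V) * (S ^ W * Πm)
    ≡⟨ e₂ (c₀ ^ m₀) (V ^ V) (S ^ W) Πm ⟩
  c₀ ^ m₀ * S ^ W * V ^ V * Πm
    ≤⟨ *-monoˡ-≤ Πm (gibbs₂ m₀ W c₀ S) ⟩
  (c₀ + S) ^ V * (m₀ ^ m₀ * W ^ W) * Πm
    ≡⟨ e₃ ((c₀ + S) ^ V) (m₀ ^ m₀) (W ^ W) Πm ⟩
  W ^ W * ((c₀ + S) ^ V * (m₀ ^ m₀ * Πm)) ∎
  where
  c₀ = c zero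
  m₀ = m zero
  W = sum (m ∘ suc)
  S = sum (c ∘ suc)
  V = m₀ + W
  Πc = prod (λ i → c (suc i) ^ m (suc i))
  Πm = prod (λ i → m (suc i) ^ m (suc i))
  e₁ : ∀ a b x y → a * (b * x * y) ≡ b * y * (x * a)
  e₁ = solve-∀
  e₂ : ∀ a b x y → a * b * (x * y) ≡ a * x * b * y
  e₂ = solve-∀
  e₃ : ∀ a b x y → a * (b * x) * y ≡ x * (a * (b * y))
  e₃ = solve-∀

-- Finite sums and products

sum-mono-≤ : ∀ {n} {f g : Fin n → ℕ} → (∀ i → f i ≤ g i) → sum f ≤ sum g
sum-mono-≤ {zero}  f≤g = z≤n
sum-mono-≤ {suc n} f≤g = +-mono-≤ (f≤g zero) (sum-mono-≤ (f≤g ∘ suc))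

prod-mono-≤ : ∀ {n} {f g : Fin n → ℕ} → (∀ i → f i ≤ g i) → prod f ≤ prod g
prod-mono-≤ {zero}  f≤g = ≤-refl
prod-mono-≤ {suc n} f≤g = *-mono-≤ (f≤g zero) (prod-mono-≤ (f≤g ∘ suc))

term≤sum : ∀ {n} (f : Fin n → ℕ) i → f i ≤ sum f
term≤sum f zero    = m≤m+n _ _
term≤sum f (suc i) = ≤-trans (term≤sum (f ∘ suc) i) (m≤n+m _ (f zero))

sum>0⇒∃ : ∀ {n} (f : Fin n → ℕ) → 0 < sum f → ∃ λ i → 0 < f i
sum>0⇒∃ {suc n} f p with f zero in eq
... | suc _ = zero , subst (0 <_) (sym eq) z<s
... | zero  with sum>0⇒∃ (f ∘ suc) p
...   | i , q = suc i , q

prod-nonZero : ∀ {n} (f : Fin n → ℕ) → (∀ i → NonZero (f i)) → NonZero (prod f)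
prod-nonZero {zero}  f nz = _
prod-nonZero {suc n} f nz = m*n≢0 _ _ {{nz zero}} {{prod-nonZero (f ∘ suc) (nz ∘ suc)}}

prod-^-sum : ∀ {n} x (m : Fin n → ℕ) → prod (λ i → x ^ m i) ≡ x ^ sum m
prod-^-sum {zero}  x m = refl
prod-^-sum {suc n} x m =
  trans (cong (x ^ m zero *_) (prod-^-sum x (m ∘ suc))) (sym (^-distribˡ-+-* x (m zero) _))

-- The Motzkin-Straus inequality

argmax : ∀ {n} (f : Fin (suc n) → ℕ) → ∃ λ v → ∀ u → f u ≤ f v
argmax {zero}  f = zero , λ { zero → ≤-refl }
argmax {suc n} f with argmax (f ∘ suc)
... | v , max with ≤-total (f zero) (f (suc v))
...   | inj₁ p = suc v , λ { zero → p ; (suc u) → max u }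
...   | inj₂ p = zero , λ { zero → ≤-refl ; (suc u) → ≤-trans (max u) p }

0<m*n⇒0<m : ∀ m n → 0 < m * n → 0 < m
0<m*n⇒0<m (suc m) n p = z<s

0<m*n⇒0<n : ∀ m n → 0 < m * n → 0 < n
0<m*n⇒0<n m n p = 0<m*n⇒0<m n m (subst (0 <_) (*-comm m n) p)

-- Erdős' argument: let v have maximal weighted degree m and let o be the weight outside N(v).
-- Then Q(w) ≤ Q(w|N(v)) + 2om, and N(v) spans no clique on one vertex less.
motzkin-straus : ∀ k {n} (a : Fin n → Fin n → ℕ) (w : Fin n → ℕ) →
  (∀ u v → a u v ≤ 1) → (∀ u v → a u v ≡ a v u) →
  (∀ ks → length ks ≡ suc (suc k) → ¬ AllPairs (λ u v → 0 < a u v) ks) →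
  suc k * sum (λ u → sum λ v → a u v * (w u * w v)) ≤ k * (sum w * sum w)
motzkin-straus zero {n} a w _ _ free = ≤-trans (≤-reflexive (*-identityˡ Q)) (≮⇒≥ no-edge)
  where
  Q = sum (λ u → sum λ v → a u v * (w u * w v))
  no-edge : ¬ 0 < Q
  no-edge p with sum>0⇒∃ (λ u → sum λ v → a u v * (w u * w v)) p
  ... | u , q with sum>0⇒∃ (λ v → a u v * (w u * w v)) q
  ...   | v , r = free (u ∷ v ∷ []) refl ((0<m*n⇒0<m _ _ r ∷ []) ∷ [] ∷ [])
motzkin-straus (suc k) {zero} a w _ _ _ = ≤-trans (≤-reflexive (*-zeroʳ (suc (suc k)))) z≤n
motzkin-straus (suc k) {n@(suc _)} a w a≤1 a-sym free = *-cancelˡ-≤ (suc k) $ begin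
  suc k * (suc (suc k) * Q)
    ≤⟨ *-monoʳ-≤ (suc k) (*-monoʳ-≤ (suc (suc k)) split) ⟩
  suc k * (suc (suc k) * (Q′ + o * m + o * m))
    ≡⟨ e₁ k Q′ o m ⟩
  suc (suc k) * (suc k * Q′) + 2 * (suc k * suc (suc k) * (o * m))
    ≤⟨ +-monoˡ-≤ _ (*-monoʳ-≤ (suc (suc k)) (motzkin-straus k a′ w′ a′≤1 a′-sym free′)) ⟩
  suc (suc k) * (k * (m * m)) + 2 * (suc k * suc (suc k) * (o * m))
    ≡⟨ e₂ k o m ⟩
  suc (suc k) * (k * (m * m)) + 2 * (suc k * suc k * (o * m)) + 2 * (m * (suc k * o))
    -- Equality would need m = (k+1) o, the balanced situation in which the non-neighbours of v
    -- carry one of k+2 equal shares of the weight. The square then closes up by k(k+2) + 1 =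
    -- (k+1)².
    ≤⟨ +-monoʳ-≤ (suc (suc k) * (k * (m * m)) + 2 * (suc k * suc k * (o * m))) (2xy≤x²+y² m (suc k * o)) ⟩
  suc (suc k) * (k * (m * m)) + 2 * (suc k * suc k * (o * m)) + (m * m + suc k * o * (suc k * o))
    ≡⟨ e₃ k o m ⟩
  suc k * (suc k * ((m + o) * (m + o)))
    ≡⟨ cong (λ W → suc k * (suc k * (W * W))) total ⟨
  suc k * (suc k * (sum w * sum w)) ∎
  where
  deg : Fin n → ℕ
  deg u = sum (λ x → a u x * w x)
  v = proj₁ (argmax deg)
  m = deg v
  b = a v
  -- Passing to N(v) sets weights and adjacencies outside it to zero instead of shrinking the vertex
  -- set; the factors `b x * b y` in `a′` ensure that any clique of `a′` lies in N(v) and extends by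
  -- v.
  w′ out : Fin n → ℕ
  w′ x = b x * w x
  out x = (1 ∸ b x) * w x
  a′ : Fin n → Fin n → ℕ
  a′ x y = b x * b y * a x y
  o = sum out
  Q = sum (λ u → sum λ x → a u x * (w u * w x))
  Q′ = sum (λ u → sum λ x → a′ u x * (w′ u * w′ x))

  a′≤1 : ∀ u x → a′ u x ≤ 1
  a′≤1 u x = *-mono-≤ (*-mono-≤ (a≤1 v u) (a≤1 v x)) (a≤1 u x)
  a′-sym : ∀ u x → a′ u x ≡ a′ x u
  a′-sym u x = cong₂ _*_ (*-comm (b u) (b x)) (a-sym u x)
  free′ : ∀ ks → length ks ≡ suc (suc k) → ¬ AllPairs (λ u x → 0 < a′ u x) ks
  free′ (x ∷ y ∷ zs) len clique@((p ∷ ps) ∷ _) =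
    free (v ∷ x ∷ y ∷ zs) (cong suc len)
      ((nb₁ p ∷ All.map nb₂ (p ∷ ps)) ∷ AllPairs.map (0<m*n⇒0<n (b _ * b _) _) clique)
    where
    nb₁ : ∀ {u z} → 0 < a′ u z → 0 < b u
    nb₁ r = 0<m*n⇒0<m _ _ (0<m*n⇒0<m _ _ r)
    nb₂ : ∀ {u z} → 0 < a′ u z → 0 < b z
    nb₂ r = 0<m*n⇒0<n (b _) _ (0<m*n⇒0<m _ _ r)

  -- Each pair lies inside N(v) or is charged to an endpoint outside it; a pair with both endpoints
  -- outside is charged twice, hence only an inequality.
  split-point : ∀ p q A x y → p ≤ 1 → q ≤ 1 →
    A * (x * y) ≤ p * q * A * (p * x * (q * y)) + (1 ∸ p) * x * (A * y) + (1 ∸ q) * y * (A * x)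
  split-point zero q A x y _ _ = ≤-trans (≤-reflexive (eq A x y)) (m≤m+n _ _)
    where
    eq : ∀ A x y → A * (x * y) ≡ 1 * x * (A * y)
    eq = solve-∀
  split-point (suc zero) zero A x y _ _ = ≤-trans (≤-reflexive (eq A x y)) (m≤n+m _ _)
    where
    eq : ∀ A x y → A * (x * y) ≡ 1 * y * (A * x)
    eq = solve-∀
  split-point (suc zero) (suc zero) A x y _ _ =
    ≤-trans (≤-reflexive (eq A x y)) (≤-trans (m≤m+n _ _) (m≤m+n _ _))
    where
    eq : ∀ A x y → A * (x * y) ≡ 1 * 1 * A * (1 * x * (1 * y))
    eq = solve-∀
  split-point (suc (suc _)) _ _ _ _ (s≤s ()) _
  split-point (suc zero) (suc (suc _)) _ _ _ _ (s≤s ())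

  outside-edges : sum (λ u → sum λ x → out u * (a u x * w x)) ≤ o * m
  outside-edges = begin
    sum (λ u → sum λ x → out u * (a u x * w x))
      ≡⟨ sum-cong-≗ (λ u → *-distribˡ-sum (out u) (λ x → a u x * w x)) ⟨
    sum (λ u → out u * deg u)
      ≤⟨ sum-mono-≤ (λ u → *-monoʳ-≤ (out u) (proj₂ (argmax deg) u)) ⟩
    sum (λ u → out u * m)
      ≡⟨ *-distribʳ-sum m out ⟨
    o * m ∎

  split : Q ≤ Q′ + o * m + o * m
  split = begin
    Q
      ≤⟨ sum-mono-≤ (λ u → sum-mono-≤ λ x → split-point (b u) (b x) (a u x) (w u) (w x) (a≤1 v u) (a≤1 v x)) ⟩
    sum (λ u → sum λ x → F u x + G u x + H u x)
      ≡⟨ sum-cong-≗ (λ u → trans (∑-distrib-+ (λ x → F u x + G u x) (H u)) (cong (_+ sum (H u)) (∑-distrib-+ (F u) (G u)))) ⟩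
    sum (λ u → sum (F u) + sum (G u) + sum (H u))
      ≡⟨ trans (∑-distrib-+ (λ u → sum (F u) + sum (G u)) (sum ∘ H)) (cong (_+ sum (sum ∘ H)) (∑-distrib-+ (sum ∘ F) (sum ∘ G))) ⟩
    Q′ + sum (sum ∘ G) + sum (sum ∘ H)
      ≡⟨ cong (Q′ + sum (sum ∘ G) +_) (trans (∑-comm H) (sum-cong-≗ λ u → sum-cong-≗ λ x → cong (λ A → out u * (A * w x)) (a-sym x u))) ⟩
    Q′ + sum (sum ∘ G) + sum (sum ∘ G)
      ≤⟨ +-mono-≤ (+-monoʳ-≤ Q′ outside-edges) outside-edges ⟩
    Q′ + o * m + o * m ∎
    where
    F G H : Fin n → Fin n → ℕ
    F u x = a′ u x * (w′ u * w′ x)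
    G u x = out u * (a u x * w x)
    H u x = out x * (a u x * w u)

  total : sum w ≡ m + o
  total = trans (sum-cong-≗ λ x → sym (trans (sym (*-distribʳ-+ (w x) (b x) (1 ∸ b x)))
                  (trans (cong (_* w x) (m+[n∸m]≡n (a≤1 v x))) (*-identityˡ (w x)))))
                (∑-distrib-+ w′ out)

  e₁ : ∀ k Q o m → suc k * (suc (suc k) * (Q + o * m + o * m)) ≡ suc (suc k) * (suc k * Q) + 2 * (suc k * suc (suc k) * (o * m))
  e₁ = solve-∀
  e₂ : ∀ k o m → suc (suc k) * (k * (m * m)) + 2 * (suc k * suc (suc k) * (o * m)) ≡
                 suc (suc k) * (k * (m * m)) + 2 * (suc k * suc k * (o * m)) + 2 * (m * (suc k * o))
  e₂ = solve-∀
  e₃ : ∀ k o m → suc (suc k) * (k * (m * m)) + 2 * (suc k * suc k * (o * m)) + (m * m + suc k * o * (suc k * o)) ≡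
                 suc k * (suc k * ((m + o) * (m + o)))
  e₃ = solve-∀

-- Sums, products and Gibbs' inequality over tuples

module _ {n : ℕ} where

  Tuple : Set
  Tuple = List (Fin n)

  sumₜ prodₜ : ℕ → (Tuple → ℕ) → ℕ
  sumₜ zero    f = f []
  sumₜ (suc k) f = sum λ v → sumₜ k (f ∘ (v ∷_))
  prodₜ zero    f = f []
  prodₜ (suc k) f = prod λ v → prodₜ k (f ∘ (v ∷_))

  sumₜ-mono-≤ : ∀ k {f g} → (∀ t → length t ≡ k → f t ≤ g t) → sumₜ k f ≤ sumₜ k g
  sumₜ-mono-≤ zero    f≤g = f≤g [] refl
  sumₜ-mono-≤ (suc k) f≤g = sum-mono-≤ λ v → sumₜ-mono-≤ k λ t p → f≤g (v ∷ t) (cong suc p)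

  sumₜ-cong : ∀ k {f g} → (∀ t → f t ≡ g t) → sumₜ k f ≡ sumₜ k g
  sumₜ-cong zero    f≗g = f≗g []
  sumₜ-cong (suc k) f≗g = sum-cong-≗ λ v → sumₜ-cong k (f≗g ∘ (v ∷_))

  sumₜ-++ : ∀ j k f → sumₜ j (λ A → sumₜ k (λ t → f (A ++ t))) ≡ sumₜ (j + k) f
  sumₜ-++ zero    k f = refl
  sumₜ-++ (suc j) k f = sum-cong-≗ λ v → sumₜ-++ j k (f ∘ (v ∷_))

  sumₜ-distrib-+ : ∀ k f g → sumₜ k (λ t → f t + g t) ≡ sumₜ k f + sumₜ k g
  sumₜ-distrib-+ zero    f g = refl
  sumₜ-distrib-+ (suc k) f g =
    trans (sum-cong-≗ λ v → sumₜ-distrib-+ k (f ∘ (v ∷_)) (g ∘ (v ∷_)))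
          (∑-distrib-+ (λ v → sumₜ k (f ∘ (v ∷_))) (λ v → sumₜ k (g ∘ (v ∷_))))

  sumₜ-zero : ∀ k → sumₜ k (λ _ → 0) ≡ 0
  sumₜ-zero zero    = refl
  sumₜ-zero (suc k) = trans (sum-cong-≗ {n} λ _ → sumₜ-zero k) (sum-replicate-zero n)

  sumₜ>0⇒∃ : ∀ k f → 0 < sumₜ k f → ∃ λ t → length t ≡ k × 0 < f t
  sumₜ>0⇒∃ zero    f p = [] , refl , p
  sumₜ>0⇒∃ (suc k) f p with sum>0⇒∃ (λ v → sumₜ k (f ∘ (v ∷_))) p
  ... | v , q with sumₜ>0⇒∃ k (f ∘ (v ∷_)) q
  ...   | t , len , r = v ∷ t , cong suc len , r

  prodₜ-nonZero : ∀ k f → (∀ t → length t ≡ k → NonZero (f t)) → NonZero (prodₜ k f)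
  prodₜ-nonZero zero    f nz = nz [] refl
  prodₜ-nonZero (suc k) f nz = prod-nonZero _ λ v → prodₜ-nonZero k (f ∘ (v ∷_)) λ t len → nz (v ∷ t) (cong suc len)

  prodₜ-one : ∀ k f → (∀ t → f t ≡ 1) → prodₜ k f ≡ 1
  prodₜ-one zero    f f≡1 = f≡1 []
  prodₜ-one (suc k) f f≡1 = trans (prod-cong λ v → prodₜ-one k (f ∘ (v ∷_)) (f≡1 ∘ (v ∷_)))
    (trans (prod-^-sum {n} 1 (λ _ → 1)) (^-zeroˡ (sum {n} (λ _ → 1))))

  -- Chain rule for relative entropy: the induction hypothesis conditioned on the first entry, then
  -- `gibbs` for the law of that entry. `ΠW` carries the conditional total masses and cancels.
  gibbsₜ : ∀ k (m c : Tuple → ℕ) →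
    prodₜ k (λ t → c t ^ m t) * sumₜ k m ^ sumₜ k m ≤ sumₜ k c ^ sumₜ k m * prodₜ k (λ t → m t ^ m t)
  gibbsₜ zero    m c = ≤-refl
  gibbsₜ (suc k) m c = *-cancelˡ-≤ ΠW {{prod-nonZero _ λ v → self^-nonZero (W v)}} $ begin
    ΠW * (prod Πc * sum W ^ sum W)
      ≡⟨ e₁ ΠW (prod Πc) (sum W ^ sum W) ⟩
    prod Πc * ΠW * sum W ^ sum W
      ≡⟨ cong (_* sum W ^ sum W) (prod-distrib-* Πc (λ v → W v ^ W v)) ⟨
    prod (λ v → Πc v * W v ^ W v) * sum W ^ sum W
      ≤⟨ *-monoˡ-≤ (sum W ^ sum W) (prod-mono-≤ λ v → gibbsₜ k (m ∘ (v ∷_)) (c ∘ (v ∷_))) ⟩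
    prod (λ v → C v ^ W v * Πm v) * sum W ^ sum W
      ≡⟨ cong (_* sum W ^ sum W) (prod-distrib-* (λ v → C v ^ W v) Πm) ⟩
    prod (λ v → C v ^ W v) * prod Πm * sum W ^ sum W
      ≡⟨ e₂ (prod (λ v → C v ^ W v)) (prod Πm) (sum W ^ sum W) ⟩
    prod (λ v → C v ^ W v) * sum W ^ sum W * prod Πm
      ≤⟨ *-monoˡ-≤ (prod Πm) (gibbs W C) ⟩
    sum C ^ sum W * ΠW * prod Πm
      ≡⟨ e₃ (sum C ^ sum W) ΠW (prod Πm) ⟩
    ΠW * (sum C ^ sum W * prod Πm) ∎
    where
    W C Πc Πm : Fin n → ℕ
    W v = sumₜ k (m ∘ (v ∷_))
    C v = sumₜ k (c ∘ (v ∷_))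
    Πc v = prodₜ k (λ t → c (v ∷ t) ^ m (v ∷ t))
    Πm v = prodₜ k (λ t → m (v ∷ t) ^ m (v ∷ t))
    ΠW = prod λ v → W v ^ W v
    e₁ : ∀ a b c → a * (b * c) ≡ b * a * c
    e₁ = solve-∀
    e₂ : ∀ a b c → a * b * c ≡ a * c * b
    e₂ = solve-∀
    e₃ : ∀ a b c → a * b * c ≡ b * (a * c)
    e₃ = solve-∀

  -- Entropy drops for symmetric weights

  Symm : (Tuple → ℕ) → Set
  Symm f = ∀ {s t} → s ↭ t → f s ≡ f t

  codeg : ℕ → (Tuple → ℕ) → Tuple → ℕ
  codeg k f A = sumₜ k (λ t → f (A ++ t))

  -- The offset makes `c` the parameter of `motzkin-straus`: cliques have at most c+1 vertices.
  -- Lists may repeat a vertex, so loops are excluded as well.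
  NoClique : ℕ → ℕ → (Tuple → ℕ) → Set
  NoClique c k f = ∀ ks → length ks ≡ suc (suc c) → ¬ AllPairs (λ u v → 0 < codeg k f (u ∷ v ∷ [])) ks

  -- A clique in the link of w becomes larger by w itself: each codegree in the link is, up to
  -- reordering, one summand of the codegrees of all three pairs among w, u, v. Lists here have at
  -- least two entries, so every vertex has a pair that shows its adjacency to w.
  noClique-link : ∀ c k f → Symm f → NoClique (suc c) (suc k) f → ∀ w → NoClique c k (f ∘ (w ∷_))
  noClique-link c k f f-sym free w (x ∷ y ∷ zs) len clique@((p ∷ ps) ∷ _) =
    free (w ∷ x ∷ y ∷ zs) (cong suc len)
      ((adj-wu p ∷ All.map adj-wv (p ∷ ps)) ∷ AllPairs.map adj-uv clique)
    where
    Adj′ : Fin n → Fin n → Set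
    Adj′ u v = 0 < sumₜ k (λ t → f (w ∷ u ∷ v ∷ t))
    adj-wu : ∀ {u v} → Adj′ u v → 0 < codeg (suc k) f (w ∷ u ∷ [])
    adj-wu {u} {v} r = <-≤-trans r (term≤sum (λ v → sumₜ k (λ t → f (w ∷ u ∷ v ∷ t))) v)
    adj-wv : ∀ {u v} → Adj′ u v → 0 < codeg (suc k) f (w ∷ v ∷ [])
    adj-wv {u} {v} r = <-≤-trans (subst (0 <_) (sumₜ-cong k λ t → f-sym (prep w (swap u v ↭-refl))) r)
      (term≤sum (λ u → sumₜ k (λ t → f (w ∷ v ∷ u ∷ t))) u)
    adj-uv : ∀ {u v} → Adj′ u v → 0 < codeg (suc k) f (u ∷ v ∷ [])
    adj-uv {u} {v} r = <-≤-trans (subst (0 <_) (sumₜ-cong k λ t →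
        trans (f-sym (swap w u ↭-refl)) (f-sym (prep u (swap w v ↭-refl)))) r)
      (term≤sum (λ w → sumₜ k (λ t → f (u ∷ v ∷ w ∷ t))) w)

  -- If (X₁,…,X_{j+k}) has distribution f / M, then P j k f = M^M · 2^{-M H(X₁,…,X_j)} (as 0^0 = 1).
  P : ℕ → ℕ → (Tuple → ℕ) → ℕ
  P j k f = prodₜ j (λ A → codeg k f A ^ codeg k f A)

  P-nonZero : ∀ j k f → NonZero (P j k f)
  P-nonZero j k f = prodₜ-nonZero j _ λ A _ → self^-nonZero (codeg k f A)

  sign : ℕ → ℕ
  sign zero    = 0
  sign (suc _) = 1

  sign≤1 : ∀ x → sign x ≤ 1
  sign≤1 zero    = z≤n
  sign≤1 (suc _) = ≤-refl

  0<sign⇒0< : ∀ x → 0 < sign x → 0 < x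
  0<sign⇒0< (suc _) _ = z<s

  sign-* : ∀ x y → (sign x * y) ^ x ≡ y ^ x
  sign-* zero      y = refl
  sign-* x@(suc _) y = cong (_^ x) (*-identityˡ y)

  -- Gibbs compares the pair (X₁,X₂) with the product of its marginals restricted to
  -- the support, whose total mass Motzkin–Straus bounds.
  entropy-drop₀ : ∀ k s f → Symm f → NoClique (suc s) k f →
    (2 + s) ^ sumₜ (2 + k) f * (P 1 (suc k) f * P 1 (suc k) f) ≤ (1 + s) ^ sumₜ (2 + k) f * (P 0 (2 + k) f * P 2 k f)
  entropy-drop₀ k s f f-sym free = *-cancelʳ-≤ _ _ (W ^ W) {{self^-nonZero W}} $ begin
    (2 + s) ^ W * (P₁ * P₁) * W ^ W
      ≡⟨ *-assoc ((2 + s) ^ W) (P₁ * P₁) (W ^ W) ⟩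
    (2 + s) ^ W * (P₁ * P₁ * W ^ W)
      ≡⟨ cong (λ q → (2 + s) ^ W * (q * W ^ W)) marginals ⟨
    (2 + s) ^ W * (prodₜ 2 (λ t → c t ^ m t) * W ^ W)
      ≤⟨ *-monoʳ-≤ ((2 + s) ^ W) (gibbsₜ 2 m c) ⟩
    (2 + s) ^ W * (sumₜ 2 c ^ W * P 2 k f)
      ≡⟨ *-assoc ((2 + s) ^ W) (sumₜ 2 c ^ W) (P 2 k f) ⟨
    (2 + s) ^ W * sumₜ 2 c ^ W * P 2 k f
      ≡⟨ cong (_* P 2 k f) (^-distribʳ-* W (2 + s) (sumₜ 2 c)) ⟨
    ((2 + s) * sumₜ 2 c) ^ W * P 2 k f
      ≤⟨ *-monoˡ-≤ (P 2 k f) (^-monoˡ-≤ W (motzkin-straus (suc s) a d (λ u v → sign≤1 (μ u v)) (λ u v → cong sign (μ-sym u v)) free′)) ⟩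
    ((1 + s) * (W * W)) ^ W * P 2 k f
      ≡⟨ cong (_* P 2 k f) (trans (^-distribʳ-* W (1 + s) (W * W)) (cong ((1 + s) ^ W *_) (^-distribʳ-* W W W))) ⟩
    (1 + s) ^ W * (W ^ W * W ^ W) * P 2 k f
      ≡⟨ e ((1 + s) ^ W) (W ^ W) (P 2 k f) ⟩
    (1 + s) ^ W * (W ^ W * P 2 k f) * W ^ W ∎
    where
    W = sumₜ (2 + k) f
    P₁ = P 1 (suc k) f
    m c : Tuple → ℕ
    m = codeg k f
    μ a : Fin n → Fin n → ℕ
    μ u v = codeg k f (u ∷ v ∷ [])
    -- The indicator of the support leaves the product in `marginals` unchanged, since where it
    -- vanishes the exponent `μ u v` is 0; yet it lowers the mass of `c` from W² to the sum that
    -- `motzkin-straus` bounds.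
    a u v = sign (μ u v)
    d : Fin n → ℕ
    d u = codeg (suc k) f (u ∷ [])
    c (u ∷ v ∷ []) = a u v * (d u * d v)
    c _            = 0
    μ-sym : ∀ u v → μ u v ≡ μ v u
    μ-sym u v = sumₜ-cong k λ t → f-sym (swap u v ↭-refl)
    free′ : ∀ ks → length ks ≡ suc (suc (suc s)) → ¬ AllPairs (λ u v → 0 < a u v) ks
    free′ ks len clique = free ks len (AllPairs.map (0<sign⇒0< _) clique)
    marginals : prodₜ 2 (λ t → c t ^ m t) ≡ P₁ * P₁
    marginals = begin-equality
      prod (λ u → prod λ v → (a u v * (d u * d v)) ^ μ u v)
        ≡⟨ prod-cong (λ u → prod-cong λ v → trans (sign-* (μ u v) (d u * d v)) (^-distribʳ-* (μ u v) (d u) (d v))) ⟩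
      prod (λ u → prod λ v → d u ^ μ u v * d v ^ μ u v)
        ≡⟨ prod-cong (λ u → prod-distrib-* (λ v → d u ^ μ u v) (λ v → d v ^ μ u v)) ⟩
      prod (λ u → prod (λ v → d u ^ μ u v) * prod (λ v → d v ^ μ u v))
        ≡⟨ prod-distrib-* (λ u → prod (λ v → d u ^ μ u v)) (λ u → prod (λ v → d v ^ μ u v)) ⟩
      prod (λ u → prod λ v → d u ^ μ u v) * prod (λ u → prod λ v → d v ^ μ u v)
        ≡⟨ cong₂ _*_ first (trans (prod-comm λ u v → d v ^ μ u v)
             (trans (prod-cong λ v → prod-cong λ u → cong (d v ^_) (μ-sym u v)) first)) ⟩
      P₁ * P₁ ∎
      where
      -- The exponents of `d u` add up to the marginal, which is `d u` itself.
      first : prod (λ u → prod λ v → d u ^ μ u v) ≡ P₁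
      first = prod-cong λ u → prod-^-sum (d u) (μ u)
    e : ∀ x y z → x * (y * y) * z ≡ x * (y * z) * y
    e = solve-∀

  -- Fixing a vertex costs one in the clique bound. The claim for f is the product over v of the
  -- claims for its links: the exponents M v add up, and each side has two factors `P`, so the
  -- different normalisations of the links balance.
  entropy-drop : ∀ j k s f → Symm f → NoClique (j + suc s) (j + k) f →
    (2 + s) ^ sumₜ (j + (2 + k)) f * (P (1 + j) (1 + k) f * P (1 + j) (1 + k) f)
      ≤ (1 + s) ^ sumₜ (j + (2 + k)) f * (P j (2 + k) f * P (2 + j) k f)
  entropy-drop zero    k s f f-sym free = entropy-drop₀ k s f f-sym free
  entropy-drop (suc j) k s f f-sym free = begin
    (2 + s) ^ sum M * (prod B * prod B)
      ≡⟨ collect (2 + s) B B ⟨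
    prod (λ v → (2 + s) ^ M v * (B v * B v))
      ≤⟨ prod-mono-≤ (λ v → entropy-drop j k s (f ∘ (v ∷_)) (f-sym ∘ prep v) (noClique-link (j + suc s) (j + k) f f-sym free v)) ⟩
    prod (λ v → (1 + s) ^ M v * (A v * C v))
      ≡⟨ collect (1 + s) A C ⟩
    (1 + s) ^ sum M * (prod A * prod C) ∎
    where
    M A B C : Fin n → ℕ
    M v = sumₜ (j + (2 + k)) (f ∘ (v ∷_))
    A v = P j (2 + k) (f ∘ (v ∷_))
    B v = P (1 + j) (1 + k) (f ∘ (v ∷_))
    C v = P (2 + j) k (f ∘ (v ∷_))
    collect : ∀ x (F G : Fin n → ℕ) → prod (λ v → x ^ M v * (F v * G v)) ≡ x ^ sum M * (prod F * prod G)
    collect x F G = trans (prod-distrib-* (λ v → x ^ M v) (λ v → F v * G v))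
                          (cong₂ _*_ (prod-^-sum x M) (prod-distrib-* F G))

-- Telescoping the entropy drops

-- The product (b+1)(b+2)...(b+k) = (b+k)!/b!, which collects the numerators of the telescoped
-- ratios.
rising : ℕ → ℕ → ℕ
rising b zero    = 1
rising b (suc k) = (b + suc k) * rising b k

module _ (p b M : ℕ) (R : ℕ → ℕ → ℕ) (R-nonZero : ∀ j k → NonZero (R j k)) (R-last : R (suc p) 0 ≡ 1)
  (drop : ∀ j k → j + suc k ≡ p →
    (b + suc k) ^ M * (R (1 + j) (1 + k) * R (1 + j) (1 + k)) ≤ (b + k) ^ M * (R j (2 + k) * R (2 + j) k)) where

  -- With `R j k` read as `P j k f`, the quotient of `R j (1 + k)` by `R (1 + j) k` is 2^(M c) for c
  -- = c_(j+1), and `R p 1` is this quotient for the last term, as `R-last` makes its denominator 1.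
  -- The drops telescope to c_(j+1) ≥ c_(p+1) + log((b+k)/b).
  ratio-chain : ∀ k j → j + k ≡ p → (b + k) ^ M * (R p 1 * R (1 + j) k) ≤ (b + 0) ^ M * R j (1 + k)
  ratio-chain zero j j≡p rewrite trans (sym (+-identityʳ j)) j≡p | R-last | *-identityʳ (R p 1) = ≤-refl
  ratio-chain (suc k) j eq = *-cancelʳ-≤ _ _ X {{R-nonZero (1 + j) (1 + k)}} $ begin
    e (suc k) * (R p 1 * X) * X                  ≡⟨ e₁ (e (suc k)) (R p 1) X ⟩
    e (suc k) * (X * X) * R p 1                  ≤⟨ *-monoˡ-≤ (R p 1) (drop j k eq) ⟩
    e k * (R j (2 + k) * R (2 + j) k) * R p 1    ≡⟨ e₂ (e k) (R j (2 + k)) (R (2 + j) k) (R p 1) ⟩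
    R j (2 + k) * (e k * (R p 1 * R (2 + j) k))  ≤⟨ *-monoʳ-≤ (R j (2 + k)) (ratio-chain k (suc j) (trans (sym (+-suc j k)) eq)) ⟩
    R j (2 + k) * (e 0 * X)                      ≡⟨ e₃ (R j (2 + k)) (e 0) X ⟩
    e 0 * R j (2 + k) * X                        ∎
    where
    e : ℕ → ℕ
    e i = (b + i) ^ M
    X = R (1 + j) (1 + k)
    e₁ : ∀ a b x → a * (b * x) * x ≡ a * (x * x) * b
    e₁ = solve-∀
    e₂ : ∀ a b c d → a * (b * c) * d ≡ b * (a * (d * c))
    e₂ = solve-∀
    e₃ : ∀ a b c → a * (b * c) ≡ b * a * c
    e₃ = solve-∀

  -- `R j (1 + k)` is 2^(M c) for c = c_(j+1) + ... + c_(p+1), so this adds up the bounds of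
  -- `ratio-chain`, one for each term before the last.
  product-chain : ∀ k j → j + k ≡ p → R p 1 ^ (1 + k) * rising b k ^ M ≤ ((b + 0) ^ M) ^ k * R j (1 + k)
  product-chain zero j j≡p rewrite trans (sym (+-identityʳ j)) j≡p | ^-zeroˡ M = ≤-reflexive (e (R p 1))
    where
    e : ∀ x → x * 1 * 1 ≡ 1 * x
    e = solve-∀
  product-chain (suc k) j eq = begin
    r * r ^ (1 + k) * (x * rising b k) ^ M        ≡⟨ cong (r * r ^ (1 + k) *_) (^-distribʳ-* M x (rising b k)) ⟩
    r * r ^ (1 + k) * (x ^ M * rising b k ^ M)    ≡⟨ e₁ r (r ^ (1 + k)) (x ^ M) (rising b k ^ M) ⟩
    x ^ M * r * (r ^ (1 + k) * rising b k ^ M)    ≤⟨ *-monoʳ-≤ (x ^ M * r) (product-chain k (suc j) (trans (sym (+-suc j k)) eq)) ⟩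
    x ^ M * r * (y ^ k * R (1 + j) (1 + k))       ≡⟨ e₂ (x ^ M) r (y ^ k) (R (1 + j) (1 + k)) ⟩
    y ^ k * (x ^ M * (r * R (1 + j) (1 + k)))     ≤⟨ *-monoʳ-≤ (y ^ k) (ratio-chain (suc k) j eq) ⟩
    y ^ k * (y * R j (2 + k))                     ≡⟨ e₃ (y ^ k) y (R j (2 + k)) ⟩
    y * y ^ k * R j (2 + k)                       ∎
    where
    r = R p 1
    x = b + suc k
    y = (b + 0) ^ M
    e₁ : ∀ a b c d → a * b * (c * d) ≡ c * a * (b * d)
    e₁ = solve-∀
    e₂ : ∀ a b c d → a * b * (c * d) ≡ c * (a * (b * d))
    e₂ = solve-∀
    e₃ : ∀ a b c → a * (b * c) ≡ b * a * c
    e₃ = solve-∀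

-- The inequality for weights on tuples

^-cancelʳ-≤ : ∀ k .{{_ : NonZero k}} {x y} → x ^ k ≤ y ^ k → x ≤ y
^-cancelʳ-≤ k xᵏ≤yᵏ = ≮⇒≥ λ y<x → <⇒≱ (^-monoˡ-< k y<x) xᵏ≤yᵏ

module _ {n : ℕ} where

  -- The exponentiated form of H(X₁,...,X_p) ≤ log ∑h: Gibbs against h, where `Πh` is at least 1
  -- because h is a positive integer wherever the marginal is positive.
  shadow-gibbs : ∀ p (f h : Tuple {n} → ℕ) → (∀ A → length A ≡ p → 0 < codeg 1 f A → 0 < h A) →
    sumₜ (suc p) f ^ sumₜ (suc p) f ≤ sumₜ p h ^ sumₜ (suc p) f * P p 1 f
  shadow-gibbs p f h supp = subst (λ M → M ^ M ≤ sumₜ p h ^ M * P p 1 f) total $ begin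
    W ^ W                                                    ≤⟨ m≤n*m (W ^ W) Πh {{prodₜ-nonZero p _ factor-nonZero}} ⟩
    Πh * W ^ W                                               ≤⟨ gibbsₜ p (codeg 1 f) h ⟩
    sumₜ p h ^ W * P p 1 f ∎
    where
    W = sumₜ p (codeg 1 f)
    Πh = prodₜ p (λ A → h A ^ codeg 1 f A)
    total : W ≡ sumₜ (suc p) f
    total = trans (sumₜ-++ p 1 f) (cong (λ k → sumₜ k f) (+-comm p 1))
    factor-nonZero : ∀ A → length A ≡ p → NonZero (h A ^ codeg 1 f A)
    factor-nonZero A len with codeg 1 f A | supp A len
    ... | zero  | _   = _
    ... | suc d | pos = m^n≢0 (h A) (suc d) {{>-nonZero (pos z<s)}}

  -- A 0/1 weight is a uniform distribution, so the full tuple has entropy exactly log M.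
  P-last : ∀ k f → (∀ t → f t ≤ 1) → P {n} k 0 f ≡ 1
  P-last k f f≤1 = prodₜ-one k _ λ A → self^-one (f≤1 (A ++ []))
    where
    self^-one : ∀ {x} → x ≤ 1 → x ^ x ≡ 1
    self^-one z≤n       = refl
    self^-one (s≤s z≤n) = refl

  -- Here c_r is eliminated: `shadow-gibbs`, raised to the power r = q+2, bounds it from below and
  -- `product-chain` from above, both through `R p 1`. An M-th root and one factor M are then
  -- removed, hence the separate case M = 0.
  tuple-inequality : ∀ q b f h → Symm {n} f → (∀ t → f t ≤ 1) → NoClique (b + suc q) q f →
    (∀ A → length A ≡ suc q → 0 < codeg 1 f A → 0 < h A) →
    sumₜ (2 + q) f ^ (1 + q) * rising (suc b) (1 + q) ≤ sumₜ (1 + q) h ^ (2 + q) * suc b ^ (1 + q)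
  tuple-inequality q b f h f-sym f≤1 free supp with sumₜ (2 + q) f in M-def
  ... | zero    = z≤n
  ... | M@(suc _) = *-cancelˡ-≤ M $ ^-cancelʳ-≤ M $ begin
    (M * (M ^ p * F)) ^ M
      ≡⟨ cong (_^ M) (*-assoc M (M ^ p) F) ⟨
    (M ^ suc p * F) ^ M
      ≡⟨ trans (^-distribʳ-* M (M ^ suc p) F) (cong (_* F ^ M) (^-swap M (suc p) M)) ⟩
    (M ^ M) ^ suc p * F ^ M
      ≤⟨ *-monoˡ-≤ (F ^ M) (^-monoˡ-≤ (suc p) (subst (λ M → M ^ M ≤ a ^ M * R p 1) M-def (shadow-gibbs p f h supp))) ⟩
    (a ^ M * R p 1) ^ suc p * F ^ M
      ≡⟨ trans (cong (_* F ^ M) (^-distribʳ-* (suc p) (a ^ M) (R p 1))) (*-assoc ((a ^ M) ^ suc p) (R p 1 ^ suc p) (F ^ M)) ⟩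
    (a ^ M) ^ suc p * (R p 1 ^ suc p * F ^ M)
      ≤⟨ *-monoʳ-≤ ((a ^ M) ^ suc p) (product-chain p (suc b) M R (λ j k → P-nonZero j k f) (P-last (suc p) f f≤1) drop p 0 refl) ⟩
    (a ^ M) ^ suc p * (((suc b + 0) ^ M) ^ p * R 0 (1 + p))
      ≡⟨ cong₂ (λ x y → (a ^ M) ^ suc p * ((x ^ M) ^ p * y ^ y)) (+-identityʳ (suc b)) M-def ⟩
    (a ^ M) ^ suc p * ((suc b ^ M) ^ p * M ^ M)
      ≡⟨ cong₂ (λ x y → x * (y * M ^ M)) (^-swap a M (suc p)) (^-swap (suc b) M p) ⟩
    (a ^ suc p) ^ M * ((suc b ^ p) ^ M * M ^ M)
      ≡⟨ cong ((a ^ suc p) ^ M *_) (^-distribʳ-* M (suc b ^ p) M) ⟨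
    (a ^ suc p) ^ M * (suc b ^ p * M) ^ M
      ≡⟨ ^-distribʳ-* M (a ^ suc p) (suc b ^ p * M) ⟨
    (a ^ suc p * (suc b ^ p * M)) ^ M
      ≡⟨ cong (_^ M) (e (a ^ suc p) (suc b ^ p) M) ⟩
    (M * (a ^ suc p * suc b ^ p)) ^ M ∎
    where
    p = suc q
    F = rising (suc b) p
    a = sumₜ p h
    R : ℕ → ℕ → ℕ
    R j k = P j k f
    ^-swap : ∀ x j k → (x ^ j) ^ k ≡ (x ^ k) ^ j
    ^-swap x j k = trans (^-*-assoc x j k) (trans (cong (x ^_) (*-comm j k)) (sym (^-*-assoc x k j)))
    e : ∀ x y z → x * (y * z) ≡ z * (x * y)
    e = solve-∀
    drop : ∀ j k → j + suc k ≡ p →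
      (suc b + suc k) ^ M * (R (1 + j) (1 + k) * R (1 + j) (1 + k)) ≤ (suc b + k) ^ M * (R j (2 + k) * R (2 + j) k)
    -- With ℓ = b+q+2 and k = q-j, the choice s = b+k gives the ratio (ℓ-j)/(ℓ-j-1) once j vertices
    -- are fixed.
    drop j k eq rewrite +-suc b k =
      subst (λ N → (2 + (b + k)) ^ N * (R (1 + j) (1 + k) * R (1 + j) (1 + k)) ≤ (1 + (b + k)) ^ N * (R j (2 + k) * R (2 + j) k))
            (trans (cong (λ i → sumₜ i f) (trans (+-suc j (suc k)) (cong suc eq))) M-def)
            (entropy-drop j k (b + k) f f-sym
              (subst₂ (λ c i → NoClique c i f) clique-size (sym (suc-injective (trans (sym (+-suc j k)) eq))) free))
      where
      arrange : ∀ b j k → b + (j + suc k) ≡ j + suc (b + k)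
      arrange = solve-∀
      clique-size : b + suc q ≡ j + suc (b + k)
      clique-size = trans (cong (b +_) (sym eq)) (arrange b j k)

-- Subsets and the tuples that list them

private variable
  n : ℕ

lookup-remove : ∀ (p : Subset n) v → lookup (p - v) v ≡ outside
lookup-remove (_ ∷ p) zero    = refl
lookup-remove (_ ∷ p) (suc v) = lookup-remove p v

lookup-remove′ : ∀ (p : Subset n) {u v} → u ≢ v → lookup (p - v) u ≡ lookup p u
lookup-remove′ (_ ∷ p) {zero}  {zero}  u≢v = contradiction refl u≢v
lookup-remove′ (_ ∷ p) {zero}  {suc v} u≢v = refl
lookup-remove′ (_ ∷ p) {suc u} {zero}  u≢v = cong (λ q → lookup q u) (p─⊥≡p p)
lookup-remove′ (_ ∷ p) {suc u} {suc v} u≢v = lookup-remove′ p (u≢v ∘ cong suc)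

∣remove∣ : ∀ (p : Subset n) v → lookup p v ≡ inside → suc ∣ p - v ∣ ≡ ∣ p ∣
∣remove∣ (inside  ∷ p) zero    _   = cong (suc ∘ ∣_∣) (p─⊥≡p p)
∣remove∣ (inside  ∷ p) (suc v) v∈p = cong suc (∣remove∣ p v v∈p)
∣remove∣ (outside ∷ p) (suc v) v∈p = ∣remove∣ p v v∈p

insert-remove : ∀ (p : Subset n) v → lookup p v ≡ inside → (p - v) [ v ]≔ inside ≡ p
insert-remove (inside ∷ p) zero    _   = cong (inside ∷_) (p─⊥≡p p)
insert-remove (s      ∷ p) (suc v) v∈p = cong (s ∷_) (insert-remove p v v∈p)

∣insert∣ : ∀ (p : Subset n) v → lookup p v ≡ outside → ∣ p [ v ]≔ inside ∣ ≡ suc ∣ p ∣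
∣insert∣ (outside ∷ p) zero    _   = refl
∣insert∣ (inside  ∷ p) (suc v) v∉p = cong suc (∣insert∣ p v v∉p)
∣insert∣ (outside ∷ p) (suc v) v∉p = ∣insert∣ p v v∉p

∣p∣≡0⇒p≡⊥ : ∀ (p : Subset n) → ∣ p ∣ ≡ 0 → p ≡ ⊥
∣p∣≡0⇒p≡⊥ []            _  = refl
∣p∣≡0⇒p≡⊥ (outside ∷ p) eq = cong (outside ∷_) (∣p∣≡0⇒p≡⊥ p eq)

∈-allSubsets : ∀ (p : Subset n) → p ∈ₗ allSubsets n
∈-allSubsets []            = here refl
∈-allSubsets (inside  ∷ p) = ∈-++⁺ˡ (∈-map⁺ (inside ∷_) (∈-allSubsets p))
∈-allSubsets {suc n} (outside ∷ p) = ∈-++⁺ʳ (map (inside ∷_) (allSubsets n)) (∈-map⁺ (outside ∷_) (∈-allSubsets p))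

sum-over : ∀ (p : Subset n) c → sum (λ v → if lookup p v then c else 0) ≡ ∣ p ∣ * c
sum-over []            c = refl
sum-over (inside  ∷ p) c = cong (c +_) (sum-over p c)
sum-over (outside ∷ p) c = sum-over p c

-- 1 if t lists the elements of p without repetition, else 0 (so 1 ∸ ∣ p ∣ tests p = ∅).
orders : Subset n → Tuple {n} → ℕ
orders p []      = 1 ∸ ∣ p ∣
orders p (v ∷ t) = if lookup p v then orders (p - v) t else 0

0<orders-∷ : ∀ (p : Subset n) v t → 0 < orders p (v ∷ t) → lookup p v ≡ inside × 0 < orders (p - v) t
0<orders-∷ p v t pos with lookup p v
... | inside  = refl , pos
... | outside = contradiction pos λ ()

orders≤1 : ∀ (p : Subset n) t → orders p t ≤ 1
orders≤1 p []      = m∸n≤m 1 ∣ p ∣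
orders≤1 p (v ∷ t) with lookup p v
... | inside  = orders≤1 (p - v) t
... | outside = z≤n

0<orders-[] : ∀ (p : Subset n) → 0 < orders p [] → ∣ p ∣ ≡ 0
0<orders-[] p pos with ∣ p ∣
... | zero  = refl
... | suc m = contradiction (subst (0 <_) (0∸n≡0 m) pos) λ ()

orders-length : ∀ (p : Subset n) t → 0 < orders p t → ∣ p ∣ ≡ length t
orders-length p []      pos = 0<orders-[] p pos
orders-length p (v ∷ t) pos with 0<orders-∷ p v t pos
... | v∈p , pos′ = trans (sym (∣remove∣ p v v∈p)) (cong suc (orders-length (p - v) t pos′))

orders-injective : ∀ (p q : Subset n) t → 0 < orders p t → 0 < orders q t → p ≡ q
orders-injective p q []      pos-p pos-q =
  trans (∣p∣≡0⇒p≡⊥ p (0<orders-[] p pos-p)) (sym (∣p∣≡0⇒p≡⊥ q (0<orders-[] q pos-q)))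
orders-injective p q (v ∷ t) pos-p pos-q with 0<orders-∷ p v t pos-p | 0<orders-∷ q v t pos-q
... | v∈p , pos-p′ | v∈q , pos-q′ =
  trans (sym (insert-remove p v v∈p))
        (trans (cong (_[ v ]≔ inside) (orders-injective (p - v) (q - v) t pos-p′ pos-q′)) (insert-remove q v v∈q))

orders-symm : ∀ (p : Subset n) → Symm (orders p)
orders-symm p Perm.refl        = refl
orders-symm p (prep v s↭t)     = cong (λ x → if lookup p v then x else 0) (orders-symm (p - v) s↭t)
orders-symm p (Perm.trans σ τ) = trans (orders-symm p σ) (orders-symm p τ)
orders-symm p (swap {xs = s} {ys = t} u v s↭t) with u Fin.≟ v
... | yes refl = cong (λ x → if lookup p u then (if lookup (p - u) u then x else 0) else 0) (orders-symm (p - u - u) s↭t)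
... | no u≢v
  rewrite lookup-remove′ p u≢v | lookup-remove′ p (u≢v ∘ sym) | p─x─y≡p─y─x p u v | orders-symm (p - v - u) s↭t
  with lookup p u | lookup p v
...   | inside  | inside  = refl
...   | inside  | outside = refl
...   | outside | inside  = refl
...   | outside | outside = refl

sum-orders : ∀ k (p : Subset n) → ∣ p ∣ ≡ k → sumₜ k (orders p) ≡ k !
sum-orders zero    p eq rewrite eq = refl
sum-orders {n} (suc k) p eq = begin-equality
  sum (λ v → sumₜ k (λ t → orders p (v ∷ t)))    ≡⟨ sum-cong-≗ link ⟩
  sum (λ v → if lookup p v then k ! else 0)      ≡⟨ sum-over p (k !) ⟩
  ∣ p ∣ * k !                                    ≡⟨ cong (_* k !) eq ⟩
  suc k * k ! ∎
  where
  link : ∀ v → sumₜ k (λ t → orders p (v ∷ t)) ≡ (if lookup p v then k ! else 0)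
  link v with lookup p v in v∈p
  ... | inside  = sum-orders k (p - v) (suc-injective (trans (∣remove∣ p v v∈p) eq))
  ... | outside = sumₜ-zero {n} k

ordersOf : List (Subset n) → Tuple {n} → ℕ
ordersOf []      t = 0
ordersOf (e ∷ E) t = orders e t + ordersOf E t

ordersOf-symm : ∀ (E : List (Subset n)) → Symm (ordersOf E)
ordersOf-symm []      σ = refl
ordersOf-symm (e ∷ E) σ = cong₂ _+_ (orders-symm e σ) (ordersOf-symm E σ)

sum-ordersOf : ∀ k (E : List (Subset n)) → All (λ e → ∣ e ∣ ≡ k) E → sumₜ k (ordersOf E) ≡ length E * k !
sum-ordersOf {n} k [] [] = sumₜ-zero {n} k
sum-ordersOf k (e ∷ E) (eq ∷ eqs) =
  trans (sumₜ-distrib-+ k (orders e) (ordersOf E)) (cong₂ _+_ (sum-orders k e eq) (sum-ordersOf k E eqs))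

0<ordersOf⁻ : ∀ (E : List (Subset n)) t → 0 < ordersOf E t → Any (λ e → 0 < orders e t) E
0<ordersOf⁻ (e ∷ E) t pos with orders e t in eq
... | suc _ = here (subst (0 <_) (sym eq) z<s)
... | zero  = there (0<ordersOf⁻ E t pos)

0<ordersOf⁺ : ∀ (E : List (Subset n)) t → Any (λ e → 0 < orders e t) E → 0 < ordersOf E t
0<ordersOf⁺ (e ∷ E) t (here pos)  = <-≤-trans pos (m≤m+n _ _)
0<ordersOf⁺ (e ∷ E) t (there any) = <-≤-trans (0<ordersOf⁺ E t any) (m≤n+m _ (orders e t))

-- A tuple determines the set it lists, so distinct edges contribute to disjoint sets of tuples.
-- This makes the random ordered edge uniform.
ordersOf≤1 : ∀ (E : List (Subset n)) → Unique E → ∀ t → ordersOf E t ≤ 1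
ordersOf≤1 []      _          t = z≤n
ordersOf≤1 (e ∷ E) (e∉E ∷ !E) t with orders e t in eq
... | zero  = ordersOf≤1 E !E t
... | suc m with ordersOf E t in eq′
...   | zero  = ≤-trans (≤-reflexive (trans (+-identityʳ (suc m)) (sym eq))) (orders≤1 e t)
...   | suc _ with find (0<ordersOf⁻ E t (subst (0 <_) (sym eq′) z<s))
...     | e′ , e′∈E , pos′ =
  contradiction (orders-injective e e′ t (subst (0 <_) (sym eq) z<s) pos′) (All.lookup e∉E e′∈E)

-- Shadows and cliques of the edge weight

module _ {n q : ℕ} (H : RGraph n (2 + q)) where

  shadow-uniform : All (λ A → ∣ A ∣ ≡ suc q) (shadow H)
  shadow-uniform = All.map proj₁ (All.all-filter (λ A → (∣ A ∣ ≟ suc q) ×-dec any? (A ⊆?_) (edges H)) (allSubsets n))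

  shadow-supports : ∀ A → length A ≡ suc q → 0 < codeg 1 (ordersOf (edges H)) A → 0 < ordersOf (shadow H) A
  shadow-supports A len pos with sum>0⇒∃ (λ v → ordersOf (edges H) (A ++ v ∷ [])) pos
  -- `orders` peels entries off the front, so symmetry moves the extra vertex v there; A then lists
  -- `e - v`, a set in the shadow.
  ... | v , pos-v with find (0<ordersOf⁻ (edges H) (A ++ v ∷ []) pos-v)
  ...   | e , e∈H , pos-e with 0<orders-∷ e v A (subst (0 <_) (orders-symm e (++-comm A (v ∷ []))) pos-e)
  ...     | v∈e , pos-A = 0<ordersOf⁺ (shadow H) A (lose e-v∈∂H pos-A)
    where
    e-v∈∂H : (e - v) ∈ₗ shadow H
    e-v∈∂H = ∈-filter⁺ (λ A → (∣ A ∣ ≟ suc q) ×-dec any? (A ⊆?_) (edges H)) (∈-allSubsets (e - v))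
      (trans (orders-length (e - v) A pos-A) len , lose e∈H (p─q⊆p e _))

Covered : List (Subset n) → Fin n → Fin n → Set
Covered E u v = u ≢ v × Any (λ e → u ∈ₛ e × v ∈ₛ e) E

-- Distinctness comes for free: `orders` removes u from the edge before it looks for v.
adjacent⇒covered : ∀ k (E : List (Subset n)) {u v} → 0 < codeg k (ordersOf E) (u ∷ v ∷ []) → Covered E u v
adjacent⇒covered k E {u} {v} pos with sumₜ>0⇒∃ k (λ t → ordersOf E (u ∷ v ∷ t)) pos
... | t , _ , pos-t with find (0<ordersOf⁻ E (u ∷ v ∷ t) pos-t)
...   | e , e∈E , pos-e with 0<orders-∷ e u (v ∷ t) pos-e
...     | u∈e , pos-e′ with 0<orders-∷ (e - u) v t pos-e′
...       | v∈e-u , _ = u≢v ,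
  lose e∈E (lookup⇒[]= u e u∈e , lookup⇒[]= v e (trans (sym (lookup-remove′ e (u≢v ∘ sym))) v∈e-u))
  where
  u≢v : u ≢ v
  u≢v refl = contradiction (trans (sym v∈e-u) (lookup-remove e u)) λ ()

fromList : List (Fin n) → Subset n
fromList = foldr (λ v p → p [ v ]≔ inside) ⊥

fromList⁻ : ∀ ks {v : Fin n} → lookup (fromList ks) v ≡ inside → v ∈ₗ ks
fromList⁻ [] {v} v∈⊥ = contradiction (lookup⇒[]= v ⊥ v∈⊥) ∉⊥
fromList⁻ (k ∷ ks) {v} v∈S with v Fin.≟ k
... | yes refl = here refl
... | no v≢k   = there (fromList⁻ ks (trans (sym (lookup∘updateAt′ v k v≢k (fromList ks))) v∈S))

∣fromList∣ : ∀ (ks : List (Fin n)) → Unique ks → ∣ fromList ks ∣ ≡ length ks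
∣fromList∣ {n} []  _        = ∣⊥∣≡0 n
∣fromList∣ (k ∷ ks) (k∉ks ∷ !ks) = trans (∣insert∣ (fromList ks) k k∉S) (cong suc (∣fromList∣ ks !ks))
  where
  k∉S : lookup (fromList ks) k ≡ outside
  k∉S with lookup (fromList ks) k in eq
  ... | outside = refl
  ... | inside  = contradiction refl (All.lookup k∉ks (fromList⁻ ks eq))

Covers : List (Subset n) → Fin n → Fin n → Set
Covers F u v = Any (λ e → u ∈ₛ e × v ∈ₛ e) F

star-cover : ∀ (E : List (Subset n)) u ks → All (Covered E u) ks →
  ∃ λ F → All (_∈ₗ E) F × length F ≡ length ks × All (Covers F u) ks
star-cover E u []       []                = [] , [] , refl , []
star-cover E u (v ∷ ks) ((_ , cov) ∷ covs) with find cov | star-cover E u ks covs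
... | e , e∈E , uv∈e | F , F⊆E , len , covF =
  e ∷ F , e∈E ∷ F⊆E , cong suc len , here uv∈e ∷ All.map there covF

-- One edge is chosen per pair, and Pascal's rule counts the pairs. The same edge may be chosen
-- several times.
clique-cover : ∀ (E : List (Subset n)) ks → AllPairs (Covered E) ks →
  ∃ λ F → All (_∈ₗ E) F × length F ≡ length ks C 2 × (∀ {u v} → u ∈ₗ ks → v ∈ₗ ks → u ≢ v → Covers F u v)
clique-cover E []       []             = [] , [] , refl , λ ()
clique-cover E (k ∷ ks) (covs ∷ clique) with star-cover E k ks covs | clique-cover E ks clique
... | F , F⊆E , lenF , covF | G , G⊆E , lenG , covG = F ++ G , All.++⁺ F⊆E G⊆E , len , cov
  where
  len : length (F ++ G) ≡ suc (length ks) C 2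
  len = trans (length-++ F) (trans (cong₂ _+_ (trans lenF (sym (nC1≡n (length ks)))) lenG)
                                   (nCk+nC[k+1]≡[n+1]C[k+1] (length ks) 1))
  cov : ∀ {u v} → u ∈ₗ k ∷ ks → v ∈ₗ k ∷ ks → u ≢ v → Covers (F ++ G) u v
  cov (here refl) (here refl) u≢v = contradiction refl u≢v
  cov (here refl) (there v∈)  u≢v = Any.++⁺ˡ (All.lookup covF v∈)
  cov (there u∈)  (here refl) u≢v = Any.++⁺ˡ (Any.map (λ (x , y) → y , x) (All.lookup covF u∈))
  cov (there u∈)  (there v∈)  u≢v = Any.++⁺ʳ F (covG u∈ v∈ u≢v)

kFree⇒noClique : ∀ c k {r} (H : RGraph n r) → KFree (suc c) H → NoClique c k (ordersOf (edges H))
kFree⇒noClique c k H free ks len adj with clique-cover (edges H) ks (AllPairs.map (adjacent⇒covered k (edges H)) adj)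
... | F , F⊆E , lenF , cov =
  -- Repeated choices are dropped to obtain a set of edges; this only shortens the list, and only an
  -- upper bound on its length is required.
  free (deduplicate _≟ₛ_ F , DecUnique.deduplicate-! _≟ₛ_ F , All.deduplicate⁺ _≟ₛ_ F⊆E
       , ≤-trans (length-deduplicate _≟ₛ_ F) (≤-reflexive (trans lenF (cong (_C 2) len)))
       , fromList ks , trans (∣fromList∣ ks distinct) len
       , λ u v u∈S v∈S u≢v → keep (cov (fromList⁻ ks ([]=⇒lookup u∈S)) (fromList⁻ ks ([]=⇒lookup v∈S)) u≢v))
  where
  _≟ₛ_ = ≡-dec Bool._≟_
  distinct : Unique ks
  distinct = AllPairs.map (proj₁ ∘ adjacent⇒covered k (edges H)) adj
  keep : ∀ {u v} → Covers F u v → Covers (deduplicate _≟ₛ_ F) u v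
  keep any with find any
  ... | e , e∈F , uv∈e = lose (∈-deduplicate⁺ _≟ₛ_ e∈F) uv∈e

-- Binomial coefficients and the conclusion

rising-! : ∀ b k → rising b k * b ! ≡ (b + k) !
rising-! b zero    = trans (*-identityˡ (b !)) (cong _! (sym (+-identityʳ b)))
rising-! b (suc k) rewrite +-suc b k = trans (*-assoc (suc (b + k)) (rising b k) (b !)) (cong (suc (b + k) *_) (rising-! b k))

choose-! : ∀ b k → ((b + k) C k) * (k ! * b !) ≡ (b + k) !
choose-! b k = subst (λ m → ((b + k) C k) * (k ! * m !) ≡ (b + k) !) (m+n∸n≡m b k)
  (trans (cong (_* (k ! * (b + k ∸ k) !)) (nCk≡n!/k![n-k]! (m≤n+m k b)))
         (m/n*n≡m {{k !* (b + k ∸ k) !≢0}} (k![n∸k]!∣n! (m≤n+m k b))))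

choose-rising : ∀ b k → ((b + k) C k) * k ! ≡ rising b k
choose-rising b k = *-cancelʳ-≡ _ _ (b !) {{b !≢0}}
  (trans (*-assoc ((b + k) C k) (k !) (b !)) (trans (choose-! b k) (sym (rising-! b k))))

choose-rising-suc : ∀ b k → ((suc b + k) C suc k) * suc k ! ≡ rising (suc b) k * suc b
choose-rising-suc b k = *-cancelʳ-≡ _ _ (b !) {{b !≢0}} $ begin-equality
  ((suc b + k) C suc k) * suc k ! * b !   ≡⟨ cong (λ m → (m C suc k) * suc k ! * b !) (+-suc b k) ⟨
  ((b + suc k) C suc k) * suc k ! * b !   ≡⟨ *-assoc ((b + suc k) C suc k) (suc k !) (b !) ⟩
  ((b + suc k) C suc k) * (suc k ! * b !) ≡⟨ choose-! b (suc k) ⟩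
  (b + suc k) !                         ≡⟨ cong _! (+-suc b k) ⟩
  (suc b + k) !                         ≡⟨ rising-! (suc b) k ⟨
  rising (suc b) k * (suc b * b !)      ≡⟨ *-assoc (rising (suc b) k) (suc b) (b !) ⟨
  rising (suc b) k * suc b * b ! ∎

theorem5p1 : (ℓ r : ℕ) → 2 ≤ r → r ≤ ℓ → (n : ℕ) (H : RGraph n r) → KFree ℓ H →
    size H ^ (r ∸ 1) * (ℓ C (r ∸ 1)) ^ r ≤ shadowSize H ^ r * (ℓ C r) ^ (r ∸ 1)
theorem5p1 ℓ r@(suc p@(suc q)) (s≤s (s≤s z≤n)) r≤ℓ n H free with m≤n⇒∃[o]m+o≡n r≤ℓ
-- The common factor turns set counts into counts of ordered tuples and both binomials into falling
-- factorials of ℓ: F = ℓ(ℓ-1)...(ℓ-r+2) and F (ℓ-r+1), where b = ℓ-r. What remains is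
-- `tuple-inequality` times `F ^ p`.
... | b , refl = *-cancelʳ-≤ _ _ ((r !) ^ p * (p !) ^ r) {{K-nonZero}} $ begin
  h ^ p * c₁ ^ r * ((r !) ^ p * (p !) ^ r)
    ≡⟨ regroup h c₁ (r !) (p !) p r ⟩
  (h * r !) ^ p * (c₁ * p !) ^ r
    ≡⟨ cong₂ (λ x y → x ^ p * y ^ r) M-eq c₁-eq ⟩
  M ^ p * (F * F ^ p)
    ≡⟨ *-assoc (M ^ p) F (F ^ p) ⟨
  M ^ p * F * F ^ p
    ≤⟨ *-monoˡ-≤ (F ^ p) (tuple-inequality q b f g (ordersOf-symm (edges H)) (ordersOf≤1 (edges H) (unique H)) noClique (shadow-supports H)) ⟩
  a ^ r * suc b ^ p * F ^ p
    ≡⟨ trans (*-assoc (a ^ r) (suc b ^ p) (F ^ p)) (cong (a ^ r *_) (trans (sym (^-distribʳ-* p (suc b) F)) (cong (_^ p) (*-comm (suc b) F)))) ⟩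
  a ^ r * (F * suc b) ^ p
    ≡⟨ cong₂ (λ x y → x ^ r * y ^ p) a-eq c₂-eq ⟨
  (s * p !) ^ r * (c₂ * r !) ^ p
    ≡⟨ regroup s c₂ (p !) (r !) r p ⟨
  s ^ r * c₂ ^ p * ((p !) ^ r * (r !) ^ p)
    ≡⟨ cong (s ^ r * c₂ ^ p *_) (*-comm ((p !) ^ r) ((r !) ^ p)) ⟩
  s ^ r * c₂ ^ p * ((r !) ^ p * (p !) ^ r) ∎
  where
  h = size H
  s = shadowSize H
  c₁ = (r + b) C p
  c₂ = (r + b) C r
  f = ordersOf (edges H)
  g = ordersOf (shadow H)
  M = sumₜ r f
  a = sumₜ p g
  F = rising (suc b) p
  ℓ-eq : r + b ≡ suc b + p
  ℓ-eq = cong suc (+-comm p b)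
  M-eq : h * r ! ≡ M
  M-eq = sym (sum-ordersOf r (edges H) (uniform H))
  a-eq : s * p ! ≡ a
  a-eq = sym (sum-ordersOf p (shadow H) (shadow-uniform H))
  c₁-eq : c₁ * p ! ≡ F
  c₁-eq = trans (cong (λ m → (m C p) * p !) ℓ-eq) (choose-rising (suc b) p)
  c₂-eq : c₂ * r ! ≡ F * suc b
  c₂-eq = trans (cong (λ m → (m C r) * r !) ℓ-eq) (choose-rising-suc b p)
  noClique : NoClique (b + p) q f
  noClique = kFree⇒noClique (b + p) q H (subst (λ m → KFree m H) ℓ-eq free)
  K-nonZero : NonZero ((r !) ^ p * (p !) ^ r)
  K-nonZero = m*n≢0 _ _ {{m^n≢0 (r !) p {{r !≢0}}}} {{m^n≢0 (p !) r {{p !≢0}}}}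
  regroup : ∀ x y u v i j → x ^ i * y ^ j * (u ^ i * v ^ j) ≡ (x * u) ^ i * (y * v) ^ j
  regroup x y u v i j = trans (arrange (x ^ i) (y ^ j) (u ^ i) (v ^ j))
                              (sym (cong₂ _*_ (^-distribʳ-* i x u) (^-distribʳ-* j y v)))
    where
    arrange : ∀ x y u v → x * y * (u * v) ≡ x * u * (y * v)
    arrange = solve-∀
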